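{- A pointed $(n+d,d)$-matching field is linkage if and only if its reduction is an $(n,d)$-matching left-semi-ensemble. Consequently, reduction is a bijection between linkage pointed $(n+d,d)$-matching fields and $(n,d)$-matching left-semi-ensembles.
   Context: Let $n,d$ be positive integers, $[\bar d]=\{\bar1,\dots,\bar d\}$, and $[\underline d]=\{\underline1,\dots,\underline d\}$ a further copy of $[d]$. A pointed $(n+d,d)$-matching field assigns to every $d$-element subset $\sigma\subseteq[n]\sqcup[\underline d]$ a bijection $M_\sigma:\sigma\to[\bar d]$ such that $M_\sigma(\underline j)=\bar j$ whenever $\underline j\in\sigma$; each $M_\sigma$ is viewed as a perfect matching graph between $\sigma$ and $[\bar d]$. It is linkage if for every $(d+1)$-element subset $\tau\subseteq[n]\sqcup[\underline d]$, the union of the graphs $M_\sigma$ over all $d$-subsets $\sigma\subset\tau$ is a spanning tree on $\tau\sqcup[\bar d]$ in which every vertex of $[\bar d]$ has degree $2$. An $(n,d)$-matching stack is a collection of bijections (partial matchings) $M_{I,\bar J}$ between $I$ and $\bar J$, one for each pair $I\subseteq[n]$, $\bar J\subseteq[\bar d]$ with $|I|=|\bar J|$, viewed as subgraphs of the complete bipartite graph on $[n]\sqcup[\bar d]$. It is a matching left-semi-ensemble if (Closure) whenever $I'\subseteq I$, $\bar J'\subseteq\bar J$ and $M_{I,\bar J}$ contains a perfect matching between $I'$ and $\bar J'$, then $M_{I',\bar J'}\subseteq M_{I,\bar J}$; and (Left linkage) for all $I,\bar J$ with $|I|=|\bar J|+1$, the union of $M_{I',\bar J}$ over all $I'\subset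 I$ with $|I'|=|\bar J|$ is a spanning tree on $I\sqcup\bar J$ in which every vertex of $\bar J$ has degree $2$. The reduction of a pointed matching field is the matching stack defined by: for each $d$-subset $\sigma$, let $\bar\sigma=\{\bar j:\underline j\in\sigma\}$; then $M_{\sigma\cap[n],\,[\bar d]\setminus\bar\sigma}$ is the restriction of $M_\sigma$ to $\sigma\cap[n]$. (This is a bijection between pointed matching fields and matching stacks.) -}

module Defs where

open import Data.Empty using (⊥; ⊥-elim)
open import Data.Fin using (Fin; zero; suc; _↑ˡ_; _↑ʳ_; splitAt)
open import Data.Fin.Properties using (suc-injective; ↑ˡ-injective; splitAt⁻¹-↑ˡ; splitAt⁻¹-↑ʳ)
open import Data.Fin.Subset using (Subset; inside; outside; _∈_; _⊆_; ∣_∣; ∁; ⊤)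
open import Data.Fin.Subset.Properties using (∣∁p∣≡n∸∣p∣; ∣p∣≤n; x∈∁p⇒x∉p; x∉p⇒x∈∁p; ∈⊤; _∈?_)
open import Data.List using (List; _∷_; _∷ʳ_; length)
open import Data.List.Membership.Propositional using () renaming (_∈_ to _∈ˡ_)
open import Data.List.Relation.Unary.Linked using (Linked)
open import Data.List.Relation.Unary.Unique.Propositional using (Unique)
open import Data.Nat using (ℕ; suc; _+_; _∸_; _≤_)
open import Data.Nat.Properties using (m+[n∸m]≡n)
open import Data.Product using (Σ; ∃; _×_; _,_; proj₁; proj₂)
open import Data.Sum using (_⊎_; inj₁; inj₂)
open import Data.Vec using ([]; _∷_; _++_; here; there)
open import Data.Vec.Properties using (lookup-++ˡ; lookup-++ʳ; []=⇒lookup; lookup⇒[]=)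
open import Function using (_⇔_; _⤖_; mk⤖; Bijection)
open import Function.Consequences.Propositional using (strictlySurjective⇒surjective)
open import Level using (0ℓ)
open import Relation.Binary using (Rel)
open import Relation.Binary.Construct.Closure.ReflexiveTransitive using (Star)
open import Relation.Binary.PropositionalEquality
  using (_≡_; refl; sym; trans; cong; cong₂; subst; module ≡-Reasoning)
open import Relation.Nullary using (¬_; yes; no)

private
  variable
    m n d k : ℕ

module _ {V : Set} (Adj : Rel V 0ℓ) where

  Connected : Set
  Connected = ∀ u v → Star Adj u v

  -- The cycle v, w₁, …, wₖ, v has k + 1 ≥ 3 distinct vertices.
  Cycle : V → List V → Set
  Cycle v ws = 2 ≤ length ws × Unique (v ∷ ws) × Linked Adj (v ∷ (ws ∷ʳ v))

  Acyclic : Set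
  Acyclic = ∀ v ws → ¬ Cycle v ws

  IsTree : Set
  IsTree = Connected × Acyclic

  HasDegree : V → ℕ → Set
  HasDegree v k = ∃ λ ws → Unique ws × length ws ≡ k × (∀ w → w ∈ˡ ws ⇔ Adj v w)

BipartiteGraph : Set → Set → Set₁
BipartiteGraph A B = A → B → Set

Adjacency : ∀ {A B} → BipartiteGraph A B → Rel (A ⊎ B) 0ℓ
Adjacency G (inj₁ a) (inj₂ b) = G a b
Adjacency G (inj₂ b) (inj₁ a) = G a b
Adjacency G (inj₁ _) (inj₁ _) = ⊥
Adjacency G (inj₂ _) (inj₂ _) = ⊥

IsLinkageTree : ∀ {A B} → BipartiteGraph A B → Set
IsLinkageTree G = IsTree (Adjacency G) × (∀ b → HasDegree (Adjacency G) (inj₂ b) 2)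

El : Subset m → Set
El I = Σ (Fin _) (_∈ I)

Matching : Subset m → Subset d → Set
Matching I J = El I ⤖ El J

⟦_⟧ : {I : Subset m} {J : Subset d} → Matching I J → El I → El J
⟦_⟧ = Bijection.to

Edge : {I : Subset m} {J : Subset d} → Matching I J → Fin m → Fin d → Set
Edge {I = I} M i j = Σ (i ∈ I) λ i∈I → proj₁ (⟦ M ⟧ (i , i∈I)) ≡ j

_⊆ᴱ_ : {I I′ : Subset m} {J J′ : Subset d} → Matching I J → Matching I′ J′ → Set
M ⊆ᴱ M′ = ∀ i j → Edge M i j → Edge M′ i j

-- When |τ| = k + 1, as in every use below, σ ⊆ τ is automatically strict.
UnionGraph : {J : Subset d} → (∀ (σ : Subset m) → .(∣ σ ∣ ≡ k) → Matching σ J) →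
             (τ : Subset m) → BipartiteGraph (El τ) (El J)
UnionGraph {k = k} M τ (i , _) (j , _) =
  ∃ λ σ → Σ (∣ σ ∣ ≡ k) λ ∣σ∣≡k → σ ⊆ τ × Edge (M σ ∣σ∣≡k) i j

-- [n] ⊔ [d̲] is Fin (n + d), with i ∈ [n] encoded as i ↑ˡ d and j̲ as n ↑ʳ j.
record PointedMatchingField (n d : ℕ) : Set where
  field
    matching : (σ : Subset (n + d)) → .(∣ σ ∣ ≡ d) → Matching σ (⊤ {d})
    pointed  : ∀ σ .(∣σ∣≡d : ∣ σ ∣ ≡ d) j (j̲∈σ : n ↑ʳ j ∈ σ) →
               proj₁ (⟦ matching σ ∣σ∣≡d ⟧ (n ↑ʳ j , j̲∈σ)) ≡ j

open PointedMatchingField public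

IsLinkage : PointedMatchingField n d → Set
IsLinkage {n} {d} M = ∀ τ → ∣ τ ∣ ≡ suc d → IsLinkageTree (UnionGraph (matching M) τ)

LinkageField : ℕ → ℕ → Set
LinkageField n d = Σ (PointedMatchingField n d) IsLinkage

_≈ᶠ_ : Rel (PointedMatchingField n d) 0ℓ
M ≈ᶠ M′ = ∀ σ .(∣σ∣≡d : ∣ σ ∣ ≡ _) x →
  ⟦ matching M σ ∣σ∣≡d ⟧ x ≡ ⟦ matching M′ σ ∣σ∣≡d ⟧ x

MatchingStack : ℕ → ℕ → Set
MatchingStack n d = (I : Subset n) (J : Subset d) → .(∣ I ∣ ≡ ∣ J ∣) → Matching I J

Closure : MatchingStack n d → Set
Closure N =
  ∀ I J (e : ∣ I ∣ ≡ ∣ J ∣) I′ J′ (e′ : ∣ I′ ∣ ≡ ∣ J′ ∣) →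
  I′ ⊆ I → J′ ⊆ J →
  (∃ λ (P : Matching I′ J′) → P ⊆ᴱ N I J e) →
  N I′ J′ e′ ⊆ᴱ N I J e

LeftLinkage : MatchingStack n d → Set
LeftLinkage N =
  ∀ I J → ∣ I ∣ ≡ suc ∣ J ∣ → IsLinkageTree (UnionGraph (λ I′ → N I′ J) I)

IsLeftSemiEnsemble : MatchingStack n d → Set
IsLeftSemiEnsemble N = Closure N × LeftLinkage N

LeftSemiEnsemble : ℕ → ℕ → Set
LeftSemiEnsemble n d = Σ (MatchingStack n d) IsLeftSemiEnsemble

_≈ˢ_ : Rel (MatchingStack n d) 0ℓ
N ≈ˢ N′ = ∀ I J .(e : ∣ I ∣ ≡ ∣ J ∣) x → ⟦ N I J e ⟧ x ≡ ⟦ N′ I J e ⟧ x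

∈-irrelevant : {I : Subset m} {i : Fin m} (p q : i ∈ I) → p ≡ q
∈-irrelevant here      here      = refl
∈-irrelevant (there p) (there q) = cong there (∈-irrelevant p q)

El-≡ : {I : Subset m} {x y : El I} → proj₁ x ≡ proj₁ y → x ≡ y
El-≡ {x = i , p} {y = .i , q} refl = cong (i ,_) (∈-irrelevant p q)

module _ {I : Subset n} {K : Subset d} where

  ∈-++ˡ⁺ : ∀ {i} → i ∈ I → i ↑ˡ d ∈ I ++ K
  ∈-++ˡ⁺ {i} p = lookup⇒[]= (i ↑ˡ d) (I ++ K) (trans (lookup-++ˡ I K i) ([]=⇒lookup p))

  ∈-++ʳ⁺ : ∀ {j} → j ∈ K → n ↑ʳ j ∈ I ++ K
  ∈-++ʳ⁺ {j} p = lookup⇒[]= (n ↑ʳ j) (I ++ K) (trans (lookup-++ʳ I K j) ([]=⇒lookup p))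

  ∈-++ˡ⁻ : ∀ {i} → i ↑ˡ d ∈ I ++ K → i ∈ I
  ∈-++ˡ⁻ {i} p = lookup⇒[]= i I (trans (sym (lookup-++ˡ I K i)) ([]=⇒lookup p))

  ∈-++ʳ⁻ : ∀ {j} → n ↑ʳ j ∈ I ++ K → j ∈ K
  ∈-++ʳ⁻ {j} p = lookup⇒[]= j K (trans (sym (lookup-++ʳ I K j)) ([]=⇒lookup p))

↑ˡ≢↑ʳ : ∀ {n d} (i : Fin n) (j : Fin d) → ¬ (i ↑ˡ d ≡ n ↑ʳ j)
↑ˡ≢↑ʳ zero    j ()
↑ˡ≢↑ʳ (suc i) j eq = ↑ˡ≢↑ʳ i j (suc-injective eq)

∣++∣ : (I : Subset n) (K : Subset d) → ∣ I ++ K ∣ ≡ ∣ I ∣ + ∣ K ∣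
∣++∣ []            K = refl
∣++∣ (inside  ∷ I) K = cong suc (∣++∣ I K)
∣++∣ (outside ∷ I) K = ∣++∣ I K

∣++∁∣ : (I : Subset n) (J : Subset d) → ∣ I ∣ ≡ ∣ J ∣ → ∣ I ++ ∁ J ∣ ≡ d
∣++∁∣ {d = d} I J e = begin
  ∣ I ++ ∁ J ∣         ≡⟨ ∣++∣ I (∁ J) ⟩
  ∣ I ∣ + ∣ ∁ J ∣      ≡⟨ cong₂ _+_ e (∣∁p∣≡n∸∣p∣ J) ⟩
  ∣ J ∣ + (d ∸ ∣ J ∣)  ≡⟨ m+[n∸m]≡n (∣p∣≤n J) ⟩
  d                    ∎
  where
  open ≡-Reasoning

-- Each d-subset σ of [n] ⊔ [d̲] is I ++ ∁ J for the unique pair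
-- I = σ ∩ [n], J = [d̄] ∖ σ̄, and then |I| = |J|. So the stack is indexed by
-- (I , J), and its member at (I , J) is the restriction of M σ to σ ∩ [n].
module _ (M : PointedMatchingField n d) (I : Subset n) (J : Subset d)
         .(e : ∣ I ∣ ≡ ∣ J ∣) where

  private
    Mσ : Matching (I ++ ∁ J) ⊤
    Mσ = matching M (I ++ ∁ J) (∣++∁∣ I J e)

    embed : El I → El (I ++ ∁ J)
    embed (i , i∈I) = i ↑ˡ d , ∈-++ˡ⁺ i∈I

  restrict-∈ : ∀ x → proj₁ (⟦ Mσ ⟧ (embed x)) ∈ J
  restrict-∈ x@(i , _) with proj₁ (⟦ Mσ ⟧ (embed x)) ∈? J
  ... | yes j∈J = j∈J
  ... | no  j∉J = ⊥-elim (↑ˡ≢↑ʳ i _ (cong proj₁ (Bijection.injective Mσ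
    (El-≡ (sym (pointed M _ (∣++∁∣ I J e) _ (∈-++ʳ⁺ {I = I} (x∉p⇒x∈∁p j∉J))))))))

  restrict : El I → El J
  restrict x = proj₁ (⟦ Mσ ⟧ (embed x)) , restrict-∈ x

  restrict-injective : ∀ {x y} → restrict x ≡ restrict y → x ≡ y
  restrict-injective eq = El-≡ (↑ˡ-injective d _ _
    (cong proj₁ (Bijection.injective Mσ (El-≡ (cong proj₁ eq)))))

  restrict-surjective : ∀ y → ∃ λ x → restrict x ≡ y
  restrict-surjective (j , j∈J) with Bijection.strictlySurjective Mσ (j , ∈⊤)
  ... | (x , x∈σ) , eq with splitAt n x in split
  ...   | inj₁ i with refl ← splitAt⁻¹-↑ˡ {i = x} split =
    (i , i∈I) , El-≡ (trans (cong (λ z → proj₁ (⟦ Mσ ⟧ z)) (El-≡ refl)) (cong proj₁ eq))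
    where i∈I = ∈-++ˡ⁻ {K = ∁ J} x∈σ
  ...   | inj₂ l with refl ← splitAt⁻¹-↑ʳ {i = x} split =
    ⊥-elim (x∈∁p⇒x∉p (∈-++ʳ⁻ {I = I} x∈σ) (subst (_∈ J) j≡l j∈J))
    where
    j≡l : j ≡ l
    j≡l = trans (sym (cong proj₁ eq)) (pointed M _ (∣++∁∣ I J e) l x∈σ)

reduction : PointedMatchingField n d → MatchingStack n d
reduction M I J e = mk⤖
  ( restrict-injective M I J e
  , strictlySurjective⇒surjective (restrict-surjective M I J e)
  )

{-# OPTIONS --safe #-}
module Submission where

-- If G is the tree on I ⊔ J given by left linkage at (I , J), then the graph of
-- a pointed matching field at τ = I ⊔ (complement of J) is G with a path
-- iₖ — k̄ — k̲ attached for every k ∉ J, where iₖ is the partner of k in the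
-- matching of I with J ∪ {k}; closure is what identifies the edges at J with G.
-- Attaching paths ending in leaves preserves and reflects linkage trees, so,
-- given closure, linkage and left linkage are equivalent. Closure itself follows
-- from linkage one deleted edge at a time, because a forest contains at most one
-- perfect matching between two given vertex sets.

open import Defs
open import Data.Bool.Properties using (not-involutive)
open import Data.Empty using (⊥; ⊥-elim)
open import Data.Fin using (Fin; zero; suc; toℕ; _↑ˡ_; _↑ʳ_; splitAt)
open import Data.Fin.Properties using (_≟_; any?; pigeonhole; splitAt⁻¹-↑ˡ; splitAt⁻¹-↑ʳ; ↑ˡ-injective; ↑ʳ-injective)
open import Data.Fin.Subset using (Subset; inside; outside; _∈_; _∉_; _⊆_; ∣_∣; ∁; ⊤; _∪_; ⁅_⁆; _-_)
import Data.Fin.Subset as Subset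
open import Data.Fin.Subset.Properties
  using (p─⊥≡p; p─q⊆p; x∈p∧x≢y⇒x∈p-y; ∪-identityʳ; p⊆p∪q; q⊆p∪q; x∈p∪q⁻; x∈⁅x⁆; x∈⁅y⁆⇒x≡y;
         _∈?_; ∈⊤; x∈∁p⇒x∉p; x∉p⇒x∈∁p; p⊆q⇒∁p⊇∁q; ∁p⊆∁q⇒p⊇q; ⊆-antisym;
         p⊆q⇒∣p∣≤∣q∣; p⊂q⇒∣p∣<∣q∣; ∣p∣≤n; ∣∁p∣≡n∸∣p∣; ∣⊥∣≡0)
open import Data.List using (List; []; _∷_; _∷ʳ_; [_]; initLast; _∷ʳ′_)
import Data.List as List
open import Data.List.Properties using (map-++; length-map; ++-assoc)
open import Data.List.Membership.Propositional using () renaming (_∈_ to _∈ˡ_)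
open import Data.List.Membership.Propositional.Properties using (∈-map⁺; ∈-map⁻; ∈-++⁺ʳ; ∈-∃++)
open import Data.List.Relation.Binary.Permutation.Propositional using (_↭_; ↭⇒↭ₛ)
open import Data.List.Relation.Binary.Permutation.Propositional.Properties using (++-comm; ∈-resp-↭; ↭-length)
import Data.List.Relation.Binary.Permutation.Setoid.Properties as Permutationₛ
open import Data.List.Relation.Unary.All using (All; []; _∷_)
import Data.List.Relation.Unary.All as All
open import Data.List.Relation.Unary.AllPairs using ([]; _∷_)
open import Data.List.Relation.Unary.Any using (here; there)
open import Data.List.Relation.Unary.Linked using (Linked; []; [-]; _∷_)
import Data.List.Relation.Unary.Linked as Linked
import Data.List.Relation.Unary.Linked.Properties as Linked
open import Data.List.Relation.Unary.Unique.Propositional using (Unique)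
import Data.List.Relation.Unary.Unique.Propositional.Properties as Unique
open import Data.Nat using (ℕ; zero; suc; _+_; _∸_; _≤_; _<_; z≤n; s≤s; NonZero)
open import Data.Nat.GeneralisedArithmetic using (iterate)
import Data.Nat.Properties as ℕ
open import Data.Product using (∃; ∃₂; Σ-syntax; _×_; _,_; proj₁; proj₂; map)
open import Data.Sum using (_⊎_; inj₁; inj₂; [_,_]′)
import Data.Sum as Sum
open import Data.Sum.Function.Propositional using (_⊎-↔_; _⊎-⤖_)
open import Data.Sum.Properties using (inj₁-injective; inj₂-injective)
open import Data.Vec using ([]; _∷_; _++_; here; there; take; drop)
open import Data.Vec.Properties using (++-injectiveˡ; ++-injectiveʳ; take++drop≡id)
open import Function
  using (_∘_; id; _⇔_; mk⇔; mk⤖; _↔_; mk↔ₛ′; _on_; Equivalence; Inverse; Injection; Bijection)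
open import Function.Consequences.Propositional using (strictlySurjective⇒surjective)
open import Function.Construct.Composition using (_⇔-∘_; _⤖-∘_)
open import Function.Construct.Identity using (↔-id; ⤖-id)
open import Function.Construct.Symmetry using (⇔-sym)
open import Function.Definitions using (Injective; StrictlySurjective)
open import Function.Properties.Inverse using (↔-sym; ↔⇒⤖; ↔⇒↣)
open import Function.Structures using (IsBijection)
open import Level using (0ℓ)
open import Relation.Binary using (Rel; Symmetric)
open import Relation.Binary.Construct.Closure.ReflexiveTransitive using (Star; ε; _◅_; _◅◅_; kleisliStar; gmap)
open import Relation.Binary.PropositionalEquality
  using (_≡_; _≢_; refl; sym; trans; cong; cong₂; subst; subst₂; setoid; module ≡-Reasoning)
open import Relation.Nullary using (¬_; Dec; yes; no)
open import Relation.Nullary.Decidable using (map′; ¬?; _×-dec_)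

private
  variable
    m n d : ℕ
    V W   : Set

-- Cycles and trees

module _ {R : Rel V 0ℓ} where

  Linked-split : ∀ xs {u ys} → Linked R (xs List.++ u ∷ ys) →
                 Linked R (xs ∷ʳ u) × Linked R (u ∷ ys)
  Linked-split []           l       = [-] , l
  Linked-split (x ∷ [])     (r ∷ l) = r ∷ [-] , l
  Linked-split (x ∷ y ∷ xs) (r ∷ l) with Linked-split (y ∷ xs) l
  ... | l₁ , l₂ = r ∷ l₁ , l₂

  Linked-join : ∀ xs {u ys} → Linked R (xs ∷ʳ u) → Linked R (u ∷ ys) →
                Linked R (xs List.++ u ∷ ys)
  Linked-join []           l₁       l₂ = l₂
  Linked-join (x ∷ [])     (r ∷ l₁) l₂ = r ∷ l₂
  Linked-join (x ∷ y ∷ xs) (r ∷ l₁) l₂ = r ∷ Linked-join (y ∷ xs) l₁ l₂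

  -- The closed walk is cut at `u` and at `v` and its two arcs are swapped. Length and distinctness
  -- survive because the new vertex list is a permutation of the old one.
  Cycle-rotate : ∀ {v u} xs {ys} → Cycle R v (xs List.++ u ∷ ys) → Cycle R u (ys List.++ v ∷ xs)
  Cycle-rotate {v} {u} xs {ys} (2≤ , uniq , linked) =
    subst (2 ≤_) (ℕ.suc-injective (↭-length rotation)) 2≤ ,
    Permutationₛ.Unique-resp-↭ (setoid V) (↭⇒↭ₛ rotation) uniq ,
    subst (Linked R) (sym (++-assoc (u ∷ ys) (v ∷ xs) [ u ]))
      (Linked-join (u ∷ ys) (proj₂ halves) (proj₁ halves))
    where
    rotation : v ∷ xs List.++ u ∷ ys ↭ u ∷ ys List.++ v ∷ xs
    rotation = ++-comm (v ∷ xs) (u ∷ ys)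

    halves : Linked R ((v ∷ xs) ∷ʳ u) × Linked R (u ∷ (ys ∷ʳ v))
    halves = Linked-split (v ∷ xs)
      (subst (Linked R) (++-assoc (v ∷ xs) (u ∷ ys) [ v ]) linked)

  TwoNeighboursIn : V → List V → Set
  TwoNeighboursIn u vs = ∃₂ λ a b → a ≢ b × (a ∈ˡ vs × R u a) × (b ∈ˡ vs × R u b)

  -- The two neighbours are the first and the last entry of `ws`; they differ because `ws` has at
  -- least two entries and no repetition.
  Cycle-head : Symmetric R → ∀ {v ws} → Cycle R v ws → TwoNeighboursIn v ws
  Cycle-head R-sym {v} {a ∷ ws} (s≤s 1≤ , (_ ∷ a∉ ∷ _) , linked@(va ∷ _)) with initLast ws
  ... | zs ∷ʳ′ b =
    a , b , All.lookup a∉ (∈-++⁺ʳ zs (here refl)) ,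
    (here refl , va) , (there (∈-++⁺ʳ zs (here refl)) , R-sym bv)
    where
    bv : R b v
    bv = Linked.head (proj₂ (Linked-split (v ∷ a ∷ zs)
      (subst (Linked R) (++-assoc (v ∷ a ∷ zs) [ b ] [ v ]) linked)))

  -- Rotation makes any vertex of the cycle its base point. This is what keeps leaves off cycles.
  Cycle-twoNeighbours : Symmetric R → ∀ {v ws} → Cycle R v ws →
                        ∀ {u} → u ∈ˡ v ∷ ws → TwoNeighboursIn u (v ∷ ws)
  Cycle-twoNeighbours R-sym c (here refl) with Cycle-head R-sym c
  ... | a , b , a≢b , (a∈ , ua) , (b∈ , ub) = a , b , a≢b , (there a∈ , ua) , (there b∈ , ub)
  Cycle-twoNeighbours R-sym {v} c {u} (there u∈ws) with ∈-∃++ u∈ws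
  ... | xs , ys , refl with Cycle-head R-sym (Cycle-rotate xs c)
  ...   | a , b , a≢b , (a∈ , ua) , (b∈ , ub) = a , b , a≢b , (back a∈ , ua) , (back b∈ , ub)
    where
    back : ∀ {w} → w ∈ˡ ys List.++ v ∷ xs → w ∈ˡ v ∷ xs List.++ u ∷ ys
    back = ∈-resp-↭ (++-comm (u ∷ ys) (v ∷ xs)) ∘ there

module _ (R : Rel V 0ℓ) (S : Rel W 0ℓ) (f : V → W) where

  Cycle-map⁺ : Injective _≡_ _≡_ f → (∀ u v → R u v → S (f u) (f v)) →
               ∀ {v ws} → Cycle R v ws → Cycle S (f v) (List.map f ws)
  Cycle-map⁺ inj hom {v} {ws} (2≤ , uniq , linked) =
    subst (2 ≤_) (sym (length-map f ws)) 2≤ ,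
    Unique.map⁺ inj uniq ,
    subst (Linked S) (cong (f v ∷_) (map-++ f ws [ v ])) (Linked.map⁺ (Linked.map (hom _ _) linked))

  Cycle-map⁻ : (∀ u v → S (f u) (f v) → R u v) →
               ∀ {v ws} → Cycle S (f v) (List.map f ws) → Cycle R v ws
  Cycle-map⁻ hom {v} {ws} (2≤ , uniq , linked) =
    subst (2 ≤_) (length-map f ws) 2≤ ,
    Unique.map⁻ uniq ,
    Linked.map (hom _ _) (Linked.map⁻ (subst (Linked S) (cong (f v ∷_) (sym (map-++ f ws [ v ]))) linked))

  Acyclic-pullback : Injective _≡_ _≡_ f → (∀ u v → R u v → S (f u) (f v)) →
                     Acyclic S → Acyclic R
  Acyclic-pullback inj hom acyclic v ws c = acyclic (f v) (List.map f ws) (Cycle-map⁺ inj hom c)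

  -- An edge may go to a walk, possibly an empty one, so that maps collapsing edges are covered as
  -- well as homomorphisms.
  Connected-pushforward : StrictlySurjective _≡_ f →
                          (∀ u v → R u v → Star S (f u) (f v)) →
                          Connected R → Connected S
  Connected-pushforward surj hom connected x y with surj x | surj y
  ... | u , refl | v , refl = kleisliStar f (hom _ _) (connected u v)

-- Orbits of injections and alternating cycles

least : {P : ℕ → Set} → (∀ n → Dec (P n)) → ∀ n → P n →
        ∃ λ m → P m × (∀ {i} → i < m → ¬ P i)
least P? n Pn with P? 0
... | yes P0 = 0 , P0 , λ ()
least P? zero    Pn | no ¬P0 = ⊥-elim (¬P0 Pn)
least P? (suc n) Pn | no ¬P0 with least (P? ∘ suc) n Pn
... | m , Pm , below = suc m , Pm , λ { {zero} _ → ¬P0 ; {suc i} (s≤s i<m) → below i<m }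

module _ {f : V → V} where

  iterate-comm : ∀ x k → iterate f (f x) k ≡ f (iterate f x k)
  iterate-comm x zero    = refl
  iterate-comm x (suc k) = iterate-comm (f x) k

  module _ (f-injective : Injective _≡_ _≡_ f) where

    iterate-cancel : ∀ x {i j} → i < j → iterate f x i ≡ iterate f x j →
                     ∃ λ k → iterate f x (suc k) ≡ x
    iterate-cancel x {zero}  {suc j} _         eq = j , sym eq
    iterate-cancel x {suc i} {suc j} (s≤s i<j) eq = iterate-cancel x i<j
      (f-injective (trans (sym (iterate-comm x i)) (trans eq (iterate-comm x j))))

    -- Among the first `suc m` iterates two have the same index, hence coincide; injectivity of `f`
    -- cancels their common initial steps. The injection `index` is how finiteness of `V` is
    -- expressed.
    iterate-recurs : ∀ {m} {index : V → Fin m} → Injective _≡_ _≡_ index →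
                     ∀ x → ∃ λ k → iterate f x (suc k) ≡ x
    iterate-recurs {index = index} index-injective x
      with pigeonhole ℕ.≤-refl (index ∘ iterate f x ∘ toℕ)
    ... | i , j , i<j , eq = iterate-cancel x i<j (index-injective eq)

-- If f moves some x, then following x — α x — f x — α (f x) — ⋯ along the
-- f-orbit of x closes up to a cycle.
module _ {X A B : Set} {m : ℕ} {index : X → Fin m} (index-injective : Injective _≡_ _≡_ index)
         {G : BipartiteGraph A B} (acyclic : Acyclic (Adjacency G))
         {ι : X → A} (ι-injective : Injective _≡_ _≡_ ι)
         {α : X → B} (α-injective : Injective _≡_ _≡_ α)
         {f : X → X} (f-injective : Injective _≡_ _≡_ f)
         (edge : ∀ x → G (ι x) (α x)) (edge′ : ∀ x → G (ι (f x)) (α x)) where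

  private
    orbit : ℕ → X → List (A ⊎ B)
    orbit zero    x = []
    orbit (suc k) x = inj₁ (ι x) ∷ inj₂ (α x) ∷ orbit k (f x)

    orbit-linked : ∀ k x → Linked (Adjacency G) (orbit k x ∷ʳ inj₁ (ι (iterate f x k)))
    orbit-linked zero          x = [-]
    orbit-linked (suc zero)    x = edge x ∷ edge′ x ∷ [-]
    orbit-linked (suc (suc k)) x = edge x ∷ edge′ x ∷ orbit-linked (suc k) (f x)

    orbit-avoids : ∀ k y {x} → (∀ {i} → i < k → iterate f y i ≢ x) →
                   All (inj₁ (ι x) ≢_) (orbit k y) × All (inj₂ (α x) ≢_) (orbit k y)
    orbit-avoids zero    y avoid = [] , []
    orbit-avoids (suc k) y avoid with orbit-avoids k (f y) (avoid ∘ s≤s)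
    ... | left , right =
      (λ eq → avoid (s≤s z≤n) (sym (ι-injective (inj₁-injective eq)))) ∷ (λ ()) ∷ left ,
      (λ ()) ∷ (λ eq → avoid (s≤s z≤n) (sym (α-injective (inj₂-injective eq)))) ∷ right

    -- Only returns to the starting point have to be excluded: injectivity of `f` pulls any later
    -- repetition back to such a return.
    orbit-unique : ∀ k x → (∀ {i} → suc i < k → iterate f x (suc i) ≢ x) → Unique (orbit k x)
    orbit-unique zero    x avoid = []
    orbit-unique (suc k) x avoid with orbit-avoids k (f x) (avoid ∘ s≤s)
    ... | left , right = ((λ ()) ∷ left) ∷ right ∷ orbit-unique k (f x)
      (λ {i} i<k eq → avoid (ℕ.<-trans i<k ℕ.≤-refl)
        (f-injective (trans (sym (iterate-comm x (suc i))) eq)))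

  alternating-fixed : ∀ x → f x ≡ x
  alternating-fixed x with iterate-recurs f-injective index-injective x
  ... | n , returns with least (λ k → returns? (suc k)) n returns
    where
    returns? : ∀ k → Dec (iterate f x k ≡ x)
    returns? k = map′ index-injective (cong index) (index (iterate f x k) ≟ index x)
  -- The index is one less than the return time, so `zero` means that `x` returns after one step.
  ...   | zero  , eq , _     = eq
  -- The first return takes `2 + k` steps, and its minimality makes the vertices on the way
  -- distinct, so the walk is a genuine cycle.
  ...   | suc k , eq , avoid = ⊥-elim (acyclic (inj₁ (ι x)) (inj₂ (α x) ∷ orbit (suc k) (f x))
    ( s≤s (s≤s z≤n)
    , orbit-unique (2 + k) x (λ { (s≤s i<k) → avoid i<k })
    , subst (λ y → Linked (Adjacency G) (orbit (2 + k) x ∷ʳ inj₁ (ι y))) eq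
        (orbit-linked (2 + k) x) ))

-- Degrees under embeddings and isomorphisms of bipartite graphs

All-image : (f : V → W) → ∀ {ws} → All (λ w → ∃ λ v → w ≡ f v) ws → ∃ λ vs → ws ≡ List.map f vs
All-image f []                  = [] , refl
All-image f ((v , refl) ∷ ws) with All-image f ws
... | vs , refl = v ∷ vs , refl

module _ (R : Rel V 0ℓ) (S : Rel W 0ℓ) (f : V → W) (f-injective : Injective _≡_ _≡_ f)
         (full : ∀ u v → R u v ⇔ S (f u) (f v))
         (u : V) (closed : ∀ w → S (f u) w → ∃ λ v → w ≡ f v) where

  -- By `full` the image is an induced subgraph, and by `closed` the vertex `f u` has no neighbour
  -- outside it, so the two neighbour lists correspond under `f`.
  HasDegree-map⁺ : ∀ {k} → HasDegree R u k → HasDegree S (f u) k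
  HasDegree-map⁺ {k} (vs , uniq , len , nbrs) =
    List.map f vs , Unique.map⁺ f-injective uniq , trans (length-map f vs) len ,
    λ w → mk⇔ (sound w) (complete w)
    where
    sound : ∀ w → w ∈ˡ List.map f vs → S (f u) w
    sound w w∈ with ∈-map⁻ f w∈
    ... | v , v∈ , refl = Equivalence.to (full u v) (Equivalence.to (nbrs v) v∈)

    complete : ∀ w → S (f u) w → w ∈ˡ List.map f vs
    complete w s with closed w s
    ... | v , refl = ∈-map⁺ f (Equivalence.from (nbrs v) (Equivalence.from (full u v) s))

  HasDegree-map⁻ : ∀ {k} → HasDegree S (f u) k → HasDegree R u k
  HasDegree-map⁻ {k} (ws , uniq , len , nbrs)
    with All-image f (All.tabulate (λ {w} w∈ → closed w (Equivalence.to (nbrs w) w∈)))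
  ... | vs , refl =
    vs , Unique.map⁻ uniq , trans (sym (length-map f vs)) len ,
    λ v → mk⇔ (sound v) (∈-map-injective v ∘ Equivalence.from (nbrs (f v)) ∘ Equivalence.to (full u v))
    where
    sound : ∀ v → v ∈ˡ vs → R u v
    sound v v∈ = Equivalence.from (full u v) (Equivalence.to (nbrs (f v)) (∈-map⁺ f v∈))

    ∈-map-injective : ∀ v → f v ∈ˡ List.map f vs → v ∈ˡ vs
    ∈-map-injective v fv∈ with ∈-map⁻ f fv∈
    ... | v′ , v′∈ , eq = subst (_∈ˡ vs) (sym (f-injective eq)) v′∈

module _ {A B A′ B′ : Set} {G : BipartiteGraph A B} {H : BipartiteGraph A′ B′}
         (φ : A ↔ A′) (ψ : B ↔ B′)
         (G⇔H : ∀ a b → G a b ⇔ H (Inverse.to φ a) (Inverse.to ψ b)) where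

  private
    open Inverse (φ ⊎-↔ ψ) using (to; from; strictlyInverseˡ)

    Adjacency-⇔ : ∀ u v → Adjacency G u v ⇔ Adjacency H (to u) (to v)
    Adjacency-⇔ (inj₁ a) (inj₂ b) = G⇔H a b
    Adjacency-⇔ (inj₂ b) (inj₁ a) = G⇔H a b
    Adjacency-⇔ (inj₁ _) (inj₁ _) = mk⇔ id id
    Adjacency-⇔ (inj₂ _) (inj₂ _) = mk⇔ id id

    Adjacency-from : ∀ x y → Adjacency H x y → Adjacency G (from x) (from y)
    Adjacency-from x y h = Equivalence.from (Adjacency-⇔ (from x) (from y))
      (subst₂ (Adjacency H) (sym (strictlyInverseˡ x)) (sym (strictlyInverseˡ y)) h)

  IsLinkageTree-iso : IsLinkageTree G → IsLinkageTree H
  IsLinkageTree-iso ((connected , acyclic) , degree) =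
    ( Connected-pushforward (Adjacency G) (Adjacency H) to (λ w → from w , strictlyInverseˡ w)
        (λ u v r → Equivalence.to (Adjacency-⇔ u v) r ◅ ε) connected
    , Acyclic-pullback (Adjacency H) (Adjacency G) from
        (Injection.injective (↔⇒↣ (↔-sym (φ ⊎-↔ ψ)))) Adjacency-from acyclic ) ,
    λ b → subst (λ w → HasDegree (Adjacency H) w 2) (strictlyInverseˡ (inj₂ b))
      (HasDegree-map⁺ (Adjacency G) (Adjacency H) to
        (Injection.injective (↔⇒↣ (φ ⊎-↔ ψ))) Adjacency-⇔ (inj₂ (Inverse.from ψ b))
        (λ w _ → from w , sym (strictlyInverseˡ w))
        (degree (Inverse.from ψ b)))

IsLinkageTree-⇔ : {A B A′ B′ : Set} {G : BipartiteGraph A B} {H : BipartiteGraph A′ B′}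
                  (φ : A ↔ A′) (ψ : B ↔ B′) →
                  (∀ a b → G a b ⇔ H (Inverse.to φ a) (Inverse.to ψ b)) →
                  IsLinkageTree G ⇔ IsLinkageTree H
IsLinkageTree-⇔ {G = G} {H} φ ψ G⇔H = mk⇔
  (IsLinkageTree-iso φ ψ G⇔H)
  (IsLinkageTree-iso (↔-sym φ) (↔-sym ψ) λ a b →
    subst₂ (λ a′ b′ → H a′ b′ ⇔ G (Inverse.from φ a) (Inverse.from ψ b))
      (Inverse.strictlyInverseˡ φ a) (Inverse.strictlyInverseˡ ψ b)
      (⇔-sym (G⇔H (Inverse.from φ a) (Inverse.from ψ b))))

-- Attaches to the left vertex p k, for every k, a path p k — k — k through a
-- new right and a new left vertex.
attachPaths : ∀ {X Y K : Set} → BipartiteGraph X Y → (K → X) → BipartiteGraph (X ⊎ K) (Y ⊎ K)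
attachPaths G p (inj₁ x) (inj₁ y)  = G x y
attachPaths G p (inj₁ x) (inj₂ k)  = x ≡ p k
attachPaths G p (inj₂ _) (inj₁ _)  = ⊥
attachPaths G p (inj₂ k) (inj₂ k′) = k ≡ k′

module _ {X Y K : Set} {G : BipartiteGraph X Y} {p : K → X} where

  private
    R : Rel (X ⊎ Y) 0ℓ
    R = Adjacency G

    R⁺ : Rel ((X ⊎ K) ⊎ (Y ⊎ K)) 0ℓ
    R⁺ = Adjacency (attachPaths G p)

    embed : X ⊎ Y → (X ⊎ K) ⊎ (Y ⊎ K)
    embed = Sum.map inj₁ inj₁

    embed-injective : Injective _≡_ _≡_ embed
    embed-injective {inj₁ _} {inj₁ _} refl = refl
    embed-injective {inj₂ _} {inj₂ _} refl = refl

    embed-full : ∀ u v → R u v ⇔ R⁺ (embed u) (embed v)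
    embed-full (inj₁ _) (inj₁ _) = mk⇔ id id
    embed-full (inj₁ _) (inj₂ _) = mk⇔ id id
    embed-full (inj₂ _) (inj₁ _) = mk⇔ id id
    embed-full (inj₂ _) (inj₂ _) = mk⇔ id id

    embed-hom : ∀ u v → R u v → R⁺ (embed u) (embed v)
    embed-hom u v = Equivalence.to (embed-full u v)

    closed : ∀ y w → R⁺ (inj₂ (inj₁ y)) w → ∃ λ v → w ≡ embed v
    closed y (inj₁ (inj₁ x)) _ = inj₁ x , refl

    symmetric : Symmetric R⁺
    symmetric {inj₁ _} {inj₂ _} r = r
    symmetric {inj₂ _} {inj₁ _} r = r

    -- Collapses every attached path to its foot `p k`. Path edges become empty walks, which is why
    -- `retract-hom` lands in `Star R`.
    retract : (X ⊎ K) ⊎ (Y ⊎ K) → X ⊎ Y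
    retract (inj₁ (inj₁ x)) = inj₁ x
    retract (inj₁ (inj₂ k)) = inj₁ (p k)
    retract (inj₂ (inj₁ y)) = inj₂ y
    retract (inj₂ (inj₂ k)) = inj₁ (p k)

    retract-embed : ∀ v → retract (embed v) ≡ v
    retract-embed (inj₁ _) = refl
    retract-embed (inj₂ _) = refl

    retract-hom : ∀ u v → R⁺ u v → Star R (retract u) (retract v)
    retract-hom (inj₁ (inj₁ _)) (inj₂ (inj₁ _)) r    = r ◅ ε
    retract-hom (inj₁ (inj₁ _)) (inj₂ (inj₂ _)) refl = ε
    retract-hom (inj₁ (inj₂ _)) (inj₂ (inj₂ _)) refl = ε
    retract-hom (inj₂ (inj₁ _)) (inj₁ (inj₁ _)) r    = r ◅ ε
    retract-hom (inj₂ (inj₂ _)) (inj₁ (inj₁ _)) refl = ε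
    retract-hom (inj₂ (inj₂ _)) (inj₁ (inj₂ _)) refl = ε

    path : ∀ w → Star R⁺ w (embed (retract w)) × Star R⁺ (embed (retract w)) w
    path (inj₁ (inj₁ x)) = ε , ε
    path (inj₁ (inj₂ k)) =
      (_◅_ {j = inj₂ (inj₂ k)} refl (refl ◅ ε)) , (_◅_ {j = inj₂ (inj₂ k)} refl (refl ◅ ε))
    path (inj₂ (inj₁ y)) = ε , ε
    path (inj₂ (inj₂ k)) = (refl ◅ ε) , (refl ◅ ε)

    connected⁺ : Connected R → Connected R⁺
    connected⁺ connected u v =
      proj₁ (path u) ◅◅
      gmap embed (λ {u} {v} → embed-hom u v) (connected (retract u) (retract v)) ◅◅
      proj₂ (path v)

    connected⁻ : Connected R⁺ → Connected R
    connected⁻ = Connected-pushforward R⁺ R retract (λ v → embed v , retract-embed v) retract-hom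

    -- The new left vertices are leaves, so no cycle visits them, and hence
    -- none visits the new right vertices either.
    acyclic⁺ : Acyclic R → Acyclic R⁺
    acyclic⁺ acyclic v ws c with All-image embed (All.tabulate old)
      where
      neighbours : ∀ {w} → w ∈ˡ v ∷ ws → TwoNeighboursIn {R = R⁺} w (v ∷ ws)
      neighbours = Cycle-twoNeighbours (λ {u} {w} → symmetric {u} {w}) c

      no-leaf : ∀ {k} → ¬ inj₁ (inj₂ k) ∈ˡ v ∷ ws
      no-leaf ∈c with neighbours ∈c
      ... | inj₂ (inj₂ _) , inj₂ (inj₂ _) , a≢b , (_ , refl) , (_ , refl) = a≢b refl

      old : ∀ {w} → w ∈ˡ v ∷ ws → ∃ λ u → w ≡ embed u
      old {inj₁ (inj₁ x)} _  = inj₁ x , refl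
      old {inj₁ (inj₂ k)} ∈c = ⊥-elim (no-leaf ∈c)
      old {inj₂ (inj₁ y)} _  = inj₂ y , refl
      old {inj₂ (inj₂ k)} ∈c with neighbours ∈c
      ... | inj₁ (inj₁ _) , inj₁ (inj₁ _) , a≢b , (_ , refl) , (_ , refl) = ⊥-elim (a≢b refl)
      ... | inj₁ (inj₂ _) , _ , _ , (∈c′ , _) , _ = ⊥-elim (no-leaf ∈c′)
      ... | _ , inj₁ (inj₂ _) , _ , _ , (∈c′ , _) = ⊥-elim (no-leaf ∈c′)
    ... | u ∷ us , refl = acyclic u us (Cycle-map⁻ R R⁺ embed (λ a b → Equivalence.from (embed-full a b)) c)

    acyclic⁻ : Acyclic R⁺ → Acyclic R
    acyclic⁻ = Acyclic-pullback R R⁺ embed embed-injective embed-hom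

    degree⁺ : (∀ y → HasDegree R (inj₂ y) 2) → ∀ y → HasDegree R⁺ (inj₂ y) 2
    degree⁺ degree (inj₁ y) =
      HasDegree-map⁺ R R⁺ embed embed-injective embed-full (inj₂ y) (closed y) (degree y)
    degree⁺ degree (inj₂ k) =
      inj₁ (inj₁ (p k)) ∷ inj₁ (inj₂ k) ∷ [] , ((λ ()) ∷ []) ∷ [] ∷ [] , refl , λ w → mk⇔ sound complete
      where
      sound : ∀ {w} → w ∈ˡ inj₁ (inj₁ (p k)) ∷ inj₁ (inj₂ k) ∷ [] → R⁺ (inj₂ (inj₂ k)) w
      sound (here refl)         = refl
      sound (there (here refl)) = refl

      complete : ∀ {w} → R⁺ (inj₂ (inj₂ k)) w → w ∈ˡ inj₁ (inj₁ (p k)) ∷ inj₁ (inj₂ k) ∷ []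
      complete {inj₁ (inj₁ _)} refl = here refl
      complete {inj₁ (inj₂ _)} refl = there (here refl)

    degree⁻ : (∀ y → HasDegree R⁺ (inj₂ y) 2) → ∀ y → HasDegree R (inj₂ y) 2
    degree⁻ degree y =
      HasDegree-map⁻ R R⁺ embed embed-injective embed-full (inj₂ y) (closed y) (degree (inj₁ y))

  IsLinkageTree-attachPaths : IsLinkageTree G ⇔ IsLinkageTree (attachPaths G p)
  IsLinkageTree-attachPaths = mk⇔
    (λ { ((connected , acyclic) , degree) → (connected⁺ connected , acyclic⁺ acyclic) , degree⁺ degree })
    (λ { ((connected , acyclic) , degree) → (connected⁻ connected , acyclic⁻ acyclic) , degree⁻ degree })

-- Subsets

∣p-x∣ : {p : Subset n} {x : Fin n} → x ∈ p → suc ∣ p - x ∣ ≡ ∣ p ∣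
∣p-x∣ {p = inside ∷ p} here                = cong (suc ∘ ∣_∣) (p─⊥≡p p)
∣p-x∣ {p = inside ∷ p}  (there x∈p) = cong suc (∣p-x∣ x∈p)
∣p-x∣ {p = outside ∷ p} (there x∈p) = ∣p-x∣ x∈p

∣p∪⁅x⁆∣ : {p : Subset n} {x : Fin n} → x ∉ p → ∣ p ∪ ⁅ x ⁆ ∣ ≡ suc ∣ p ∣
∣p∪⁅x⁆∣ {p = inside ∷ p}  {zero}  x∉p = ⊥-elim (x∉p here)
∣p∪⁅x⁆∣ {p = outside ∷ p} {zero}  x∉p = cong (suc ∘ ∣_∣) (∪-identityʳ p)
∣p∪⁅x⁆∣ {p = inside ∷ p}  {suc x} x∉p = cong suc (∣p∪⁅x⁆∣ (x∉p ∘ there))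
∣p∪⁅x⁆∣ {p = outside ∷ p} {suc x} x∉p = ∣p∪⁅x⁆∣ (x∉p ∘ there)

x∉p-x : (p : Subset n) (x : Fin n) → x ∉ p - x
x∉p-x (inside ∷ p)  zero    ()
x∉p-x (outside ∷ p) zero    ()
x∉p-x (_ ∷ p)       (suc x) (there x∈) = x∉p-x p x x∈

⊆-or-∃∉ : (p q : Subset n) → p ⊆ q ⊎ ∃ λ x → x ∈ p × x ∉ q
⊆-or-∃∉ p q with any? (λ x → (x ∈? p) ×-dec ¬? (x ∈? q))
... | yes counterexample = inj₂ counterexample
... | no  none = inj₁ included
  where
  included : p ⊆ q
  included {x} x∈p with x ∈? q
  ... | yes x∈q = x∈q
  ... | no  x∉q = ⊥-elim (none (x , x∈p , x∉q))

p⊆q∧∣q∣≤∣p∣⇒p≡q : {p q : Subset n} → p ⊆ q → ∣ q ∣ ≤ ∣ p ∣ → p ≡ q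
p⊆q∧∣q∣≤∣p∣⇒p≡q {p = p} {q} p⊆q ∣q∣≤∣p∣ with ⊆-or-∃∉ q p
... | inj₁ q⊆p = ⊆-antisym p⊆q q⊆p
... | inj₂ q⊈p = ⊥-elim (ℕ.<⇒≱ (p⊂q⇒∣p∣<∣q∣ (p⊆q , q⊈p)) ∣q∣≤∣p∣)

p∪⁅x⁆⊆q : {p q : Subset n} {x : Fin n} → p ⊆ q → x ∈ q → p ∪ ⁅ x ⁆ ⊆ q
p∪⁅x⁆⊆q {p = p} {x = x} p⊆q x∈q y∈ with x∈p∪q⁻ p ⁅ x ⁆ y∈
... | inj₁ y∈p = p⊆q y∈p
... | inj₂ y∈x with refl ← x∈⁅y⁆⇒x≡y x y∈x = x∈q

-- This is the set `I′ ++ ∁ J′` inside `I ++ ∁ J` with one element omitted, on the left or on the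
-- right. Once `J′` has an element `k` outside `J`, the chain
-- `∣J∣ + 1 ≤ ∣J′∣ = ∣I′∣ ≤ ∣I∣ = ∣J∣ + 1` forces all the sizes.
⊆-⊇-codimension : {I I′ : Subset m} {J J′ : Subset n} → I′ ⊆ I → J ⊆ J′ →
                  ∣ I ∣ ≡ suc ∣ J ∣ → ∣ I′ ∣ ≡ ∣ J′ ∣ →
                  J ≡ J′ ⊎ ∃ λ k → k ∉ J × J ∪ ⁅ k ⁆ ≡ J′ × I′ ≡ I
⊆-⊇-codimension {I = I} {I′} {J} {J′} I′⊆I J⊆J′ e e′ with ⊆-or-∃∉ J′ J
... | inj₁ J′⊆J = inj₁ (⊆-antisym J⊆J′ J′⊆J)
... | inj₂ (k , k∈J′ , k∉J) = inj₂ (k , k∉J , J∪⁅k⁆≡J′ , p⊆q∧∣q∣≤∣p∣⇒p≡q I′⊆I ∣I∣≤∣I′∣)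
  where
  ∣I∣≡∣J∪⁅k⁆∣ : ∣ I ∣ ≡ ∣ J ∪ ⁅ k ⁆ ∣
  ∣I∣≡∣J∪⁅k⁆∣ = trans e (sym (∣p∪⁅x⁆∣ k∉J))

  J∪⁅k⁆≡J′ : J ∪ ⁅ k ⁆ ≡ J′
  J∪⁅k⁆≡J′ = p⊆q∧∣q∣≤∣p∣⇒p≡q (p∪⁅x⁆⊆q J⊆J′ k∈J′)
    (subst₂ _≤_ e′ ∣I∣≡∣J∪⁅k⁆∣ (p⊆q⇒∣p∣≤∣q∣ I′⊆I))

  ∣I∣≤∣I′∣ : ∣ I ∣ ≤ ∣ I′ ∣
  ∣I∣≤∣I′∣ = ℕ.≤-reflexive (trans ∣I∣≡∣J∪⁅k⁆∣ (trans (cong ∣_∣ J∪⁅k⁆≡J′) (sym e′)))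

∁-involutive : (p : Subset n) → ∁ (∁ p) ≡ p
∁-involutive []      = refl
∁-involutive (s ∷ p) = cong₂ _∷_ (not-involutive s) (∁-involutive p)

∁-injective : {p q : Subset n} → ∁ p ≡ ∁ q → p ≡ q
∁-injective {p = p} {q} eq = trans (sym (∁-involutive p)) (trans (cong ∁ eq) (∁-involutive q))

-- Splitting subsets of `[n] ⊔ [d̲]`

module _ {I : Subset n} {K : Subset d} where

  El-++ : (El I ⊎ El K) ↔ El (I ++ K)
  El-++ = mk↔ₛ′ to from to-from from-to
    where
    to : El I ⊎ El K → El (I ++ K)
    to (inj₁ (i , i∈I)) = i ↑ˡ d , ∈-++ˡ⁺ i∈I
    to (inj₂ (k , k∈K)) = n ↑ʳ k , ∈-++ʳ⁺ {I = I} k∈K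

    preimage : ∀ x → ∃ λ v → to v ≡ x
    preimage (x , x∈) with splitAt n x in split
    ... | inj₁ i with refl ← splitAt⁻¹-↑ˡ {i = x} split = inj₁ (i , ∈-++ˡ⁻ {K = K} x∈) , El-≡ refl
    ... | inj₂ k with refl ← splitAt⁻¹-↑ʳ {i = x} split = inj₂ (k , ∈-++ʳ⁻ {I = I} x∈) , El-≡ refl

    to-injective : ∀ {u v} → to u ≡ to v → u ≡ v
    to-injective {inj₁ (i , _)} {inj₁ (i′ , _)} eq = cong inj₁ (El-≡ (↑ˡ-injective d i i′ (cong proj₁ eq)))
    to-injective {inj₁ (i , _)} {inj₂ (k , _)}  eq = ⊥-elim (↑ˡ≢↑ʳ i k (cong proj₁ eq))
    to-injective {inj₂ (k , _)} {inj₁ (i , _)}  eq = ⊥-elim (↑ˡ≢↑ʳ i k (sym (cong proj₁ eq)))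
    to-injective {inj₂ (k , _)} {inj₂ (k′ , _)} eq = cong inj₂ (El-≡ (↑ʳ-injective n k k′ (cong proj₁ eq)))

    from : El (I ++ K) → El I ⊎ El K
    from = proj₁ ∘ preimage

    to-from : ∀ x → to (from x) ≡ x
    to-from = proj₂ ∘ preimage

    from-to : ∀ v → from (to v) ≡ v
    from-to v = to-injective (to-from (to v))

  ++-⊆⁺ : {I′ : Subset n} {K′ : Subset d} → I′ ⊆ I → K′ ⊆ K → I′ ++ K′ ⊆ I ++ K
  ++-⊆⁺ {I′} {K′} I′⊆I K′⊆K {x} x∈ with splitAt n x in split
  ... | inj₁ i with refl ← splitAt⁻¹-↑ˡ {i = x} split = ∈-++ˡ⁺ (I′⊆I (∈-++ˡ⁻ {K = K′} x∈))
  ... | inj₂ k with refl ← splitAt⁻¹-↑ʳ {i = x} split = ∈-++ʳ⁺ {I = I} (K′⊆K (∈-++ʳ⁻ {I = I′} x∈))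

El-∁ : {J : Subset d} → (El J ⊎ El (∁ J)) ↔ El (⊤ {d})
El-∁ {d = d} {J} = mk↔ₛ′ to from to-from from-to
  where
  to : El J ⊎ El (∁ J) → El (⊤ {d})
  to = [ (λ j → proj₁ j , ∈⊤) , (λ k → proj₁ k , ∈⊤) ]′

  from : El (⊤ {d}) → El J ⊎ El (∁ J)
  from (j , _) with j ∈? J
  ... | yes j∈J = inj₁ (j , j∈J)
  ... | no  j∉J = inj₂ (j , x∉p⇒x∈∁p j∉J)

  to-from : ∀ x → to (from x) ≡ x
  to-from (j , _) with j ∈? J
  ... | yes _ = El-≡ refl
  ... | no  _ = El-≡ refl

  from-to : ∀ v → from (to v) ≡ v
  from-to (inj₁ (j , j∈J)) with j ∈? J
  ... | yes _   = cong inj₁ (El-≡ refl)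
  ... | no  j∉J = ⊥-elim (j∉J j∈J)
  from-to (inj₂ (k , k∈∁J)) with k ∈? J
  ... | yes k∈J = ⊥-elim (x∈∁p⇒x∉p k∈∁J k∈J)
  ... | no  _   = cong inj₂ (El-≡ refl)

decompose : ∀ n d (σ : Subset (n + d)) → ∃₂ λ (I : Subset n) (J : Subset d) → I ++ ∁ J ≡ σ
decompose n d σ = take n σ , ∁ (drop n σ) ,
  trans (cong (take n σ ++_) (∁-involutive (drop n σ))) (take++drop≡id n σ)

module _ (I : Subset n) (J : Subset d) where

  ∣++∁∣+∣∣ : ∣ I ++ ∁ J ∣ + ∣ J ∣ ≡ ∣ I ∣ + d
  ∣++∁∣+∣∣ = begin
    ∣ I ++ ∁ J ∣ + ∣ J ∣       ≡⟨ cong (_+ ∣ J ∣) (∣++∣ I (∁ J)) ⟩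
    (∣ I ∣ + ∣ ∁ J ∣) + ∣ J ∣  ≡⟨ ℕ.+-assoc ∣ I ∣ _ _ ⟩
    ∣ I ∣ + (∣ ∁ J ∣ + ∣ J ∣)  ≡⟨ cong (λ x → ∣ I ∣ + (x + ∣ J ∣)) (∣∁p∣≡n∸∣p∣ J) ⟩
    ∣ I ∣ + (d ∸ ∣ J ∣ + ∣ J ∣)  ≡⟨ cong (∣ I ∣ +_) (ℕ.m∸n+n≡m (∣p∣≤n J)) ⟩
    ∣ I ∣ + d                  ∎
    where open ≡-Reasoning

  -- Used with `k = 0` for the subsets that carry a matching and with `k = 1` for those that carry a
  -- linkage tree.
  ∣++∁∣⁺ : ∀ k → ∣ I ∣ ≡ k + ∣ J ∣ → ∣ I ++ ∁ J ∣ ≡ k + d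
  ∣++∁∣⁺ k e = ℕ.+-cancelʳ-≡ ∣ J ∣ _ _ (begin
    ∣ I ++ ∁ J ∣ + ∣ J ∣  ≡⟨ ∣++∁∣+∣∣ ⟩
    ∣ I ∣ + d             ≡⟨ cong (_+ d) e ⟩
    (k + ∣ J ∣) + d       ≡⟨ ℕ.+-assoc k _ _ ⟩
    k + (∣ J ∣ + d)       ≡⟨ cong (k +_) (ℕ.+-comm ∣ J ∣ d) ⟩
    k + (d + ∣ J ∣)       ≡⟨ ℕ.+-assoc k _ _ ⟨
    (k + d) + ∣ J ∣       ∎)
    where open ≡-Reasoning

  ∣++∁∣⁻ : ∀ k → ∣ I ++ ∁ J ∣ ≡ k + d → ∣ I ∣ ≡ k + ∣ J ∣
  ∣++∁∣⁻ k e = ℕ.+-cancelʳ-≡ d _ _ (begin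
    ∣ I ∣ + d             ≡⟨ ∣++∁∣+∣∣ ⟨
    ∣ I ++ ∁ J ∣ + ∣ J ∣  ≡⟨ cong (_+ ∣ J ∣) e ⟩
    (k + d) + ∣ J ∣       ≡⟨ ℕ.+-assoc k _ _ ⟩
    k + (d + ∣ J ∣)       ≡⟨ cong (k +_) (ℕ.+-comm d ∣ J ∣) ⟩
    k + (∣ J ∣ + d)       ≡⟨ ℕ.+-assoc k _ _ ⟨
    (k + ∣ J ∣) + d       ∎)
    where open ≡-Reasoning

-- Matchings

module _ {I : Subset m} {J : Subset d} (M : Matching I J) where

  Edge-∈ʳ : ∀ {i j} → Edge M i j → j ∈ J
  Edge-∈ʳ (i∈I , refl) = proj₂ (⟦ M ⟧ (_ , i∈I))

  Edge-image : ∀ x → Edge M (proj₁ x) (proj₁ (⟦ M ⟧ x))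
  Edge-image x = proj₂ x , refl

  Edge-preimage : ∀ {j} → j ∈ J → ∃ λ i → Edge M i j
  Edge-preimage j∈J with Bijection.strictlySurjective M (_ , j∈J)
  ... | (i , i∈I) , eq = i , i∈I , cong proj₁ eq

  Edge-functional : ∀ {i j j′} → Edge M i j → Edge M i j′ → j ≡ j′
  Edge-functional (p , refl) (q , refl) = cong (λ p → proj₁ (⟦ M ⟧ (_ , p))) (∈-irrelevant p q)

  Edge-injective : ∀ {i i′ j} → Edge M i j → Edge M i′ j → i ≡ i′
  Edge-injective (p , eq) (q , eq′) =
    cong proj₁ (Bijection.injective M (El-≡ (trans eq (sym eq′))))

  -- Produces the perfect matching that `Closure` takes as hypothesis: no edge of `M` has exactly
  -- one end in the chosen subsets, so `M` restricts to a bijection between them.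
  submatching : {I′ : Subset m} {J′ : Subset d} → I′ ⊆ I → J′ ⊆ J →
                (∀ {i j} → Edge M i j → i ∈ I′ ⇔ j ∈ J′) →
                ∃ λ (P : Matching I′ J′) → P ⊆ᴱ M
  submatching {I′} {J′} I′⊆I J′⊆J compatible =
    mk⤖ (f-injective , strictlySurjective⇒surjective f-surjective) ,
    λ { i _ (i∈I′ , refl) → I′⊆I i∈I′ , refl }
    where
    f : El I′ → El J′
    f (i , i∈I′) = proj₁ (⟦ M ⟧ (i , I′⊆I i∈I′)) ,
      Equivalence.to (compatible (Edge-image (i , I′⊆I i∈I′))) i∈I′

    f-injective : ∀ {x y} → f x ≡ f y → x ≡ y
    f-injective {x} {y} eq = El-≡ (Edge-injective
      (I′⊆I (proj₂ x) , cong proj₁ eq) (Edge-image (_ , I′⊆I (proj₂ y))))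

    f-surjective : ∀ y → ∃ λ x → f x ≡ y
    f-surjective (j , j∈J′) with Edge-preimage (J′⊆J j∈J′)
    ... | i , edge = (i , i∈I′) , El-≡ (Edge-functional (Edge-image (i , I′⊆I i∈I′)) edge)
      where
      i∈I′ : i ∈ I′
      i∈I′ = Equivalence.from (compatible edge) j∈J′

-- A, and B completed by the edge i — j, are perfect matchings of I with J inside
-- the same forest, and so they coincide.
module _ {I : Subset m} {J : Subset n} (A : Matching I J) {i j} (ij : Edge A i j)
         (B : Matching (I - i) (J - j))
         {V W : Set} {G : BipartiteGraph V W} (acyclic : Acyclic (Adjacency G))
         {ι : El I → V} {κ : El J → W} (ι-injective : ∀ {x y} → ι x ≡ ι y → x ≡ y)
         (κ-injective : ∀ {x y} → κ x ≡ κ y → x ≡ y)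
         (A⊆G : ∀ x y → Edge A (proj₁ x) (proj₁ y) → G (ι x) (κ y))
         (B⊆G : ∀ x y → Edge B (proj₁ x) (proj₁ y) → G (ι x) (κ y)) where

  private
    Completed : Fin m → Fin n → Set
    Completed x y = (x ≡ i × y ≡ j) ⊎ Edge B x y

    Completed-functional : ∀ {x y y′} → Completed x y → Completed x y′ → y ≡ y′
    Completed-functional (inj₁ (_ , refl)) (inj₁ (_ , refl)) = refl
    Completed-functional (inj₁ (refl , _)) (inj₂ r)          = ⊥-elim (x∉p-x I i (proj₁ r))
    Completed-functional (inj₂ r)          (inj₁ (refl , _)) = ⊥-elim (x∉p-x I i (proj₁ r))
    Completed-functional (inj₂ r)          (inj₂ r′)         = Edge-functional B r r′

    -- Goes right along `A` and back along the completed `B`; a fixed point is a vertex where the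
    -- two matchings agree. Over `j` the way back is the edge `ij`, which lies in the forest because
    -- it belongs to `A`.
    competitor : ∀ x → ∃ λ x′ → G (ι x′) (κ (⟦ A ⟧ x)) × Completed (proj₁ x′) (proj₁ (⟦ A ⟧ x))
    competitor x with proj₁ (⟦ A ⟧ x) ≟ j
    ... | yes αx≡j = (i , proj₁ ij) , A⊆G _ _ (subst (Edge A i) (sym αx≡j) ij) , inj₁ (refl , αx≡j)
    ... | no  αx≢j with Edge-preimage B (x∈p∧x≢y⇒x∈p-y (proj₂ (⟦ A ⟧ x)) αx≢j)
    ...   | x′ , edge = (x′ , p─q⊆p I ⁅ i ⁆ (proj₁ edge)) , B⊆G _ _ edge , inj₂ edge

    competitor-injective : ∀ {x y} → proj₁ (competitor x) ≡ proj₁ (competitor y) → x ≡ y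
    competitor-injective {x} {y} eq = Bijection.injective A (El-≡ (Completed-functional
      (proj₂ (proj₂ (competitor x)))
      (subst (λ x → Completed (proj₁ x) _) (sym eq) (proj₂ (proj₂ (competitor y))))))

    completed : ∀ x → Completed (proj₁ x) (proj₁ (⟦ A ⟧ x))
    completed x = subst (λ x′ → Completed (proj₁ x′) (proj₁ (⟦ A ⟧ x)))
      -- The walk alternates between `ι x` and `κ (⟦ A ⟧ x)`; a vertex moved by `competitor` would
      -- close it up to a cycle in the forest.
      (alternating-fixed {index = proj₁} El-≡ acyclic ι-injective
        (Bijection.injective A ∘ κ-injective) competitor-injective
        (λ x → A⊆G _ _ (Edge-image A x)) (λ x → proj₁ (proj₂ (competitor x))) x)
      (proj₂ (proj₂ (competitor x)))

  acyclic⇒deletion-⊆ᴱ : B ⊆ᴱ A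
  acyclic⇒deletion-⊆ᴱ x y xy with Edge-preimage A (p─q⊆p J ⁅ j ⁆ (Edge-∈ʳ B xy))
  ... | z , z∈I , refl with completed (z , z∈I)
  ...   | inj₁ (_ , eq) = ⊥-elim (x∉p-x J j (subst (_∈ J - j) eq (Edge-∈ʳ B xy)))
  ...   | inj₂ zy with refl ← Edge-injective B xy zy = z∈I , refl

-- Stacks and pointed matching fields

≈ˢ⇒Edge : {N N′ : MatchingStack n d} → N ≈ˢ N′ → ∀ I J (e : ∣ I ∣ ≡ ∣ J ∣) {i j} →
          Edge (N I J e) i j → Edge (N′ I J e) i j
≈ˢ⇒Edge N≈N′ I J e (i∈I , eq) = i∈I , trans (sym (cong proj₁ (N≈N′ I J e (_ , i∈I)))) eq

IsLeftSemiEnsemble-resp-≈ˢ : {N N′ : MatchingStack n d} → N ≈ˢ N′ →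
                             IsLeftSemiEnsemble N → IsLeftSemiEnsemble N′
IsLeftSemiEnsemble-resp-≈ˢ {N = N} {N′} N≈N′ (closure , leftLinkage) = closure′ , leftLinkage′
  where
  N′≈N : N′ ≈ˢ N
  N′≈N I J e x = sym (N≈N′ I J e x)

  forth : ∀ I J (e : ∣ I ∣ ≡ ∣ J ∣) {i j} → Edge (N I J e) i j → Edge (N′ I J e) i j
  forth = ≈ˢ⇒Edge {N = N} {N′} N≈N′

  back : ∀ I J (e : ∣ I ∣ ≡ ∣ J ∣) {i j} → Edge (N′ I J e) i j → Edge (N I J e) i j
  back = ≈ˢ⇒Edge {N = N′} {N} N′≈N

  closure′ : Closure N′
  closure′ I J e I′ J′ e′ I′⊆I J′⊆J (P , P⊆) i j edge =
    forth I J e (closure I J e I′ J′ e′ I′⊆I J′⊆J (P , λ i j → back I J e ∘ P⊆ i j) i j (back I′ J′ e′ edge))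

  leftLinkage′ : LeftLinkage N′
  leftLinkage′ I J e = IsLinkageTree-iso
    {G = UnionGraph (λ I′ → N I′ J) I} {UnionGraph (λ I′ → N′ I′ J) I} (↔-id _) (↔-id _)
    (λ _ _ → mk⇔ (λ { (σ , e , σ⊆ , edge) → σ , e , σ⊆ , forth σ J e edge })
                 (λ { (σ , e , σ⊆ , edge) → σ , e , σ⊆ , back σ J e edge }))
    (leftLinkage I J e)

module _ {N : MatchingStack n d}
         (deletion : ∀ I J (e : ∣ I ∣ ≡ ∣ J ∣) {i j} → Edge (N I J e) i j →
                     (e′ : ∣ I - i ∣ ≡ ∣ J - j ∣) → N (I - i) (J - j) e′ ⊆ᴱ N I J e) where

  private
    -- Induction on the size `s` of `I`: if `I′` misses some `i`, the edge of `N I J e` at `i` is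
    -- deleted. The smaller stack member still contains `P`, and by `deletion` it lies in `N I J e`.
    closure-below : ∀ s {I J} → ∣ I ∣ ≡ s → (e : ∣ I ∣ ≡ ∣ J ∣) → ∀ {I′ J′} (e′ : ∣ I′ ∣ ≡ ∣ J′ ∣) →
                    I′ ⊆ I → J′ ⊆ J → (P : Matching I′ J′) → P ⊆ᴱ N I J e →
                    N I′ J′ e′ ⊆ᴱ N I J e
    closure-below s {I} {J} ∣I∣≡s e {I′} {J′} e′ I′⊆I J′⊆J P P⊆ with ⊆-or-∃∉ I I′
    ... | inj₁ I⊆I′ with refl ← ⊆-antisym I′⊆I I⊆I′
                    with refl ← p⊆q∧∣q∣≤∣p∣⇒p≡q J′⊆J (ℕ.≤-reflexive (trans (sym e) e′)) = λ _ _ edge → edge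
    closure-below zero {I} ∣I∣≡s e e′ I′⊆I J′⊆J P P⊆ | inj₂ (i , i∈I , i∉I′)
      with () ← trans (∣p-x∣ i∈I) ∣I∣≡s
    closure-below (suc s) {I} {J} ∣I∣≡s e {I′} {J′} e′ I′⊆I J′⊆J P P⊆ | inj₂ (i , i∈I , i∉I′) =
      λ x y edge → step x y (closure-below s (ℕ.suc-injective (trans (∣p-x∣ i∈I) ∣I∣≡s)) e₁ e′ I′⊆I₁ J′⊆J₁ P P⊆₁ x y edge)
      where
      j : Fin _
      j = proj₁ (⟦ N I J e ⟧ (i , i∈I))

      ij : Edge (N I J e) i j
      ij = i∈I , refl

      e₁ : ∣ I - i ∣ ≡ ∣ J - j ∣
      e₁ = ℕ.suc-injective (trans (∣p-x∣ i∈I) (trans e (sym (∣p-x∣ (Edge-∈ʳ (N I J e) ij)))))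

      step : N (I - i) (J - j) e₁ ⊆ᴱ N I J e
      step = deletion I J e ij e₁

      I′⊆I₁ : I′ ⊆ I - i
      I′⊆I₁ x∈I′ = x∈p∧x≢y⇒x∈p-y (I′⊆I x∈I′) (λ { refl → i∉I′ x∈I′ })

      J′⊆J₁ : J′ ⊆ J - j
      J′⊆J₁ y∈J′ = x∈p∧x≢y⇒x∈p-y (J′⊆J y∈J′) avoid
        where
        avoid : _ ≢ j
        -- The edge of `P` at `j` would be an edge of `N I J e`, so its left end would be `i`, which
        -- is outside `I′`.
        avoid refl with Edge-preimage P y∈J′
        ... | x , xy = i∉I′ (subst (_∈ I′) (Edge-injective (N I J e) (P⊆ _ _ xy) ij) (proj₁ xy))

      P⊆₁ : P ⊆ᴱ N (I - i) (J - j) e₁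
      -- The edges at `x` of `P` and of the smaller stack member both belong to `N I J e`, which has
      -- only one edge there.
      P⊆₁ x y xy = subst (Edge (N (I - i) (J - j) e₁) x)
        (Edge-functional (N I J e) (step _ _ edge) (P⊆ _ _ xy)) edge
        where
        edge : Edge (N (I - i) (J - j) e₁) x _
        edge = Edge-image (N (I - i) (J - j) e₁) (x , I′⊆I₁ (proj₁ xy))

  deletion⇒closure : Closure N
  deletion⇒closure I J e I′ J′ e′ I′⊆I J′⊆J (P , P⊆) =
    closure-below ∣ I ∣ refl e e′ I′⊆I J′⊆J P P⊆

-- Feet of the attached paths and edges added to the stack's tree

module Pendants (N : MatchingStack n d) (closure : Closure N)
                (I : Subset n) (J : Subset d) (e : ∣ I ∣ ≡ suc ∣ J ∣) where

  ∣J∪⁅k⁆∣ : ∀ {k} → k ∉ J → ∣ I ∣ ≡ ∣ J ∪ ⁅ k ⁆ ∣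
  ∣J∪⁅k⁆∣ k∉J = trans e (sym (∣p∪⁅x⁆∣ k∉J))

  partner : (k : El (∁ J)) →
            ∃ λ i → Edge (N I (J ∪ ⁅ proj₁ k ⁆) (∣J∪⁅k⁆∣ (x∈∁p⇒x∉p (proj₂ k)))) i (proj₁ k)
  partner (k , k∈∁J) =
    Edge-preimage (N I (J ∪ ⁅ k ⁆) (∣J∪⁅k⁆∣ (x∈∁p⇒x∉p k∈∁J))) (q⊆p∪q J ⁅ k ⁆ (x∈⁅x⁆ k))

  p : El (∁ J) → El I
  p k = proj₁ (partner k) , proj₁ (proj₂ (partner k))

  -- The two kinds of d-subsets of `I ++ ∁ J`, read in the stack: the omitted element lies in `I`,
  -- or it is some `k` in `∁ J`, which then joins `J`.
  Origin : Fin n → Fin d → Set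
  Origin i j =
    (∃ λ I′ → Σ[ e′ ∈ ∣ I′ ∣ ≡ ∣ J ∣ ] I′ ⊆ I × Edge (N I′ J e′) i j) ⊎
    (∃ λ k → Σ[ k∈∁J ∈ k ∈ ∁ J ] Edge (N I (J ∪ ⁅ k ⁆) (∣J∪⁅k⁆∣ (x∈∁p⇒x∉p k∈∁J))) i j)

  toOrigin : ∀ {I′ J′ i j} → J ≡ J′ ⊎ (∃ λ k → k ∉ J × J ∪ ⁅ k ⁆ ≡ J′ × I′ ≡ I) →
             (e′ : ∣ I′ ∣ ≡ ∣ J′ ∣) → I′ ⊆ I → Edge (N I′ J′ e′) i j → Origin i j
  toOrigin {I′} (inj₁ refl)                     e′ I′⊆I edge = inj₁ (I′ , e′ , I′⊆I , edge)
  toOrigin      (inj₂ (k , k∉J , refl , refl)) e′ I′⊆I edge = inj₂ (k , x∉p⇒x∈∁p k∉J , edge)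

  module _ {k : Fin d} (k∈∁J : k ∈ ∁ J) where

    private
      k∉J : k ∉ J
      k∉J = x∈∁p⇒x∉p k∈∁J

      Nᵏ : Matching I (J ∪ ⁅ k ⁆)
      Nᵏ = N I (J ∪ ⁅ k ⁆) (∣J∪⁅k⁆∣ k∉J)

      iₖ : Fin n
      iₖ = proj₁ (partner (k , k∈∁J))

      edgeₖ : Edge Nᵏ iₖ k
      edgeₖ = proj₂ (partner (k , k∈∁J))

      J⊆J∪⁅k⁆ : J ⊆ J ∪ ⁅ k ⁆
      J⊆J∪⁅k⁆ = p⊆p∪q ⁅ k ⁆

      e⁻ : ∣ I - iₖ ∣ ≡ ∣ J ∣
      e⁻ = ℕ.suc-injective (trans (∣p-x∣ (proj₁ edgeₖ)) e)

      compatible : ∀ {i j} → Edge Nᵏ i j → i ∈ I - iₖ ⇔ j ∈ J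
      compatible {i} {j} edge = mk⇔ to from
        where
        to : i ∈ I - iₖ → j ∈ J
        to i∈ with x∈p∪q⁻ J ⁅ k ⁆ (Edge-∈ʳ Nᵏ edge)
        ... | inj₁ j∈J = j∈J
        ... | inj₂ j∈k with refl ← x∈⁅y⁆⇒x≡y k j∈k
                       with refl ← Edge-injective Nᵏ edge edgeₖ = ⊥-elim (x∉p-x I iₖ i∈)

        from : j ∈ J → i ∈ I - iₖ
        from j∈J = x∈p∧x≢y⇒x∈p-y (proj₁ edge)
          (λ { refl → k∉J (subst (_∈ J) (Edge-functional Nᵏ edge edgeₖ) j∈J) })

      -- Without the edge from `iₖ` to `k`, what remains of `Nᵏ` matches `I - iₖ` perfectly with
      -- `J`, so closure applies.
      deleted : N (I - iₖ) J e⁻ ⊆ᴱ Nᵏ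
      deleted = closure I (J ∪ ⁅ k ⁆) (∣J∪⁅k⁆∣ k∉J) (I - iₖ) J e⁻ (p─q⊆p I ⁅ iₖ ⁆) J⊆J∪⁅k⁆
        (submatching Nᵏ (p─q⊆p I ⁅ iₖ ⁆) J⊆J∪⁅k⁆ compatible)

    -- Enlarging `J` by `k` creates no new edge at `J`: the edge of `N (I - iₖ) J` at `j` lies in
    -- `Nᵏ` by `deleted`, and `Nᵏ` has only one edge at `j`.
    old-edge : ∀ {i j} → Edge Nᵏ i j → j ∈ J →
               ∃ λ I′ → Σ[ e′ ∈ ∣ I′ ∣ ≡ ∣ J ∣ ] I′ ⊆ I × Edge (N I′ J e′) i j
    old-edge {i} {j} edge j∈J with Edge-preimage (N (I - iₖ) J e⁻) j∈J
    ... | i′ , edge′ with refl ← Edge-injective Nᵏ (deleted i′ j edge′) edge =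
      I - iₖ , e⁻ , p─q⊆p I ⁅ iₖ ⁆ , edge′

    -- Among the matchings involved, only `Nᵏ` has `k` on its right side, so `k` has the foot `iₖ`
    -- as its one neighbour in `I`.
    Origin-new : ∀ {i} → Origin i k → i ≡ iₖ
    Origin-new (inj₁ (I′ , e′ , _ , edge)) = ⊥-elim (k∉J (Edge-∈ʳ (N I′ J e′) edge))
    Origin-new (inj₂ (l , l∈∁J , edge))
      with x∈p∪q⁻ J ⁅ l ⁆ (Edge-∈ʳ (N I (J ∪ ⁅ l ⁆) (∣J∪⁅k⁆∣ (x∈∁p⇒x∉p l∈∁J))) edge)
    ... | inj₁ k∈J = ⊥-elim (k∉J k∈J)
    ... | inj₂ k∈l with refl ← x∈⁅y⁆⇒x≡y l k∈l = Edge-injective Nᵏ edge edgeₖ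

  Origin-old : ∀ {i j} → j ∈ J → Origin i j →
               ∃ λ I′ → Σ[ e′ ∈ ∣ I′ ∣ ≡ ∣ J ∣ ] I′ ⊆ I × Edge (N I′ J e′) i j
  Origin-old j∈J (inj₁ edge)              = edge
  Origin-old j∈J (inj₂ (k , k∈∁J , edge)) = old-edge k∈∁J edge j∈J

-- Linkage of a field against closure and left linkage of its reduction

module _ (M : PointedMatchingField n d) where

  private
    N : MatchingStack n d
    N = reduction M

    Field : (I : Subset n) (J : Subset d) → BipartiteGraph (El (I ++ ∁ J)) (El (⊤ {d}))
    Field I J = UnionGraph (matching M) (I ++ ∁ J)

    -- `Field` on bare indices. `UnionGraph` ignores membership proofs, so the two unfold to the
    -- same type.
    FieldEdge : Subset n → Subset d → Fin (n + d) → Fin d → Set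
    FieldEdge I J x j =
      ∃ λ σ → Σ[ ∣σ∣≡d ∈ ∣ σ ∣ ≡ d ] σ ⊆ I ++ ∁ J × Edge (matching M σ ∣σ∣≡d) x j

    Stack : (I : Subset n) (J : Subset d) → BipartiteGraph (El I) (El J)
    Stack I J = UnionGraph (λ I′ → N I′ J) I

  Edge-reduction⁻ : ∀ {I J} (e : ∣ I ∣ ≡ ∣ J ∣) .(∣σ∣≡d : ∣ I ++ ∁ J ∣ ≡ d) {i j} →
                    Edge (matching M (I ++ ∁ J) ∣σ∣≡d) (i ↑ˡ d) j → Edge (N I J e) i j
  Edge-reduction⁻ {I} {J} e ∣σ∣≡d (i∈σ , eq) = ∈-++ˡ⁻ {I = I} {∁ J} i∈σ ,
    trans (cong (λ p → proj₁ (⟦ matching M (I ++ ∁ J) ∣σ∣≡d ⟧ (_ , p))) (∈-irrelevant _ i∈σ)) eq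

  Edge-pointed : ∀ {σ} .(∣σ∣≡d : ∣ σ ∣ ≡ d) {k j} → Edge (matching M σ ∣σ∣≡d) (n ↑ʳ k) j → k ≡ j
  Edge-pointed ∣σ∣≡d (k∈σ , eq) = trans (sym (pointed M _ ∣σ∣≡d _ k∈σ)) eq

  Field-stack : ∀ {I J I′ J′} → I′ ⊆ I → J ⊆ J′ → (e : ∣ I′ ∣ ≡ ∣ J′ ∣) → ∀ {i j} →
                Edge (N I′ J′ e) i j → FieldEdge I J (i ↑ˡ d) j
  Field-stack {I′ = I′} {J′} I′⊆I J⊆J′ e (i∈I′ , eq) =
    I′ ++ ∁ J′ , ∣++∁∣ I′ J′ e , ++-⊆⁺ I′⊆I (p⊆q⇒∁p⊇∁q J⊆J′) , ∈-++ˡ⁺ i∈I′ , eq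

  -- For a deleted edge `ij`, both `N I J` and `N (I - i) (J - j)` lie in the union graph at
  -- `I ++ ∁ (J - j)`. This set has `suc d` elements, so linkage makes that graph a forest, where
  -- uniqueness of perfect matchings applies.
  linkage⇒closure : IsLinkage M → Closure N
  linkage⇒closure linkage = deletion⇒closure {N = N} closure-step
    where
    closure-step : ∀ I J (e : ∣ I ∣ ≡ ∣ J ∣) {i j} → Edge (N I J e) i j →
                   (e′ : ∣ I - i ∣ ≡ ∣ J - j ∣) → N (I - i) (J - j) e′ ⊆ᴱ N I J e
    closure-step I J e {i} {j} ij e′ =
      acyclic⇒deletion-⊆ᴱ (N I J e) ij (N (I - i) (J - j) e′)
        (proj₂ (proj₁ (linkage (I ++ ∁ (J - j)) ∣τ∣)))
        {ι = λ x → proj₁ x ↑ˡ d , ∈-++ˡ⁺ (proj₂ x)} {κ = λ y → proj₁ y , ∈⊤}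
        (λ eq → El-≡ (↑ˡ-injective d _ _ (cong proj₁ eq)))
        (λ eq → El-≡ (cong proj₁ eq))
        (λ x y edge → Field-stack {I} {J - j} {I} {J} (λ p → p) (p─q⊆p J ⁅ j ⁆) e edge)
        (λ x y edge → Field-stack {I} {J - j} {I - i} {J - j} (p─q⊆p I ⁅ i ⁆) (λ p → p) e′ edge)
      where
      ∣τ∣ : ∣ I ++ ∁ (J - j) ∣ ≡ suc d
      ∣τ∣ = ∣++∁∣⁺ I (J - j) 1 (trans e (sym (∣p-x∣ (Edge-∈ʳ (N I J e) ij))))

  module _ (closure : Closure N) (I : Subset n) (J : Subset d) (e : ∣ I ∣ ≡ suc ∣ J ∣) where

    private
      open Pendants N closure I J e

      -- A d-subset of I ++ ∁ J omits one element, which is in I or in ∁ J.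
      origin : ∀ {i j} → FieldEdge I J (i ↑ˡ d) j → Origin i j
      origin {i} {j = j} (σ , ∣σ∣≡d , σ⊆τ , edge) with decompose n d σ
      ... | I′ , J′ , refl = toOrigin (⊆-⊇-codimension I′⊆I J⊆J′ e e′) e′ I′⊆I (Edge-reduction⁻ e′ ∣σ∣≡d edge)
        where
        e′ : ∣ I′ ∣ ≡ ∣ J′ ∣
        e′ = ∣++∁∣⁻ I′ J′ 0 ∣σ∣≡d

        I′⊆I : I′ ⊆ I
        I′⊆I x∈ = ∈-++ˡ⁻ {K = ∁ J} (σ⊆τ (∈-++ˡ⁺ x∈))

        J⊆J′ : J ⊆ J′
        J⊆J′ = ∁p⊆∁q⇒p⊇q (λ x∈ → ∈-++ʳ⁻ {I = I} (σ⊆τ (∈-++ʳ⁺ {I = I′} x∈)))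

      -- `I` is nonempty because it is larger than `J`. Omitting any `i` from it leaves a d-subset
      -- that still contains `n ↑ʳ k`, where pointedness gives the edge.
      pendant-edge : ∀ {k} → k ∈ ∁ J → FieldEdge I J (n ↑ʳ k) k
      pendant-edge {k} k∈∁J with ⊆-or-∃∉ I Subset.⊥
      ... | inj₁ I⊆⊥ with () ← subst₂ _≤_ e (∣⊥∣≡0 n) (p⊆q⇒∣p∣≤∣q∣ {p = I} {Subset.⊥} I⊆⊥)
      ... | inj₂ (i , i∈I , _) = (I - i) ++ ∁ J , size , ++-⊆⁺ (p─q⊆p I ⁅ i ⁆) (λ j∈ → j∈) ,
        ∈-++ʳ⁺ {I = I - i} k∈∁J , pointed M _ size k _
        where
        size : ∣ (I - i) ++ ∁ J ∣ ≡ d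
        size = ∣++∁∣ (I - i) J (ℕ.suc-injective (trans (∣p-x∣ i∈I) e))

      -- For left vertices in `I` the d-subsets are sorted by `Origin`, with closure settling the
      -- edges at `J`; for left vertices `n ↑ʳ k` pointedness leaves only the edge to `k`.
      Field-shape : ∀ a b → attachPaths (Stack I J) p a b ⇔
                    Field I J (Inverse.to El-++ a) (Inverse.to (El-∁ {J = J}) b)
      Field-shape (inj₁ (i , i∈I)) (inj₁ (j , j∈J)) = mk⇔
        (λ { (I′ , e′ , I′⊆I , edge) → Field-stack I′⊆I (λ j∈ → j∈) e′ edge })
        (λ field-edge → Origin-old j∈J (origin field-edge))
      Field-shape (inj₁ (i , i∈I)) (inj₂ (k , k∈∁J)) = mk⇔
        (λ { refl → Field-stack (λ i∈ → i∈) (p⊆p∪q ⁅ k ⁆)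
               (∣J∪⁅k⁆∣ (x∈∁p⇒x∉p k∈∁J)) (proj₂ (partner (k , k∈∁J))) })
        (λ field-edge → El-≡ (Origin-new k∈∁J (origin field-edge)))
      Field-shape (inj₂ (k , k∈∁J)) (inj₁ (j , j∈J)) = mk⇔ (λ ())
        (λ { (σ , ∣σ∣≡d , _ , edge) → x∈∁p⇒x∉p k∈∁J (subst (_∈ J) (sym (Edge-pointed ∣σ∣≡d edge)) j∈J) })
      Field-shape (inj₂ (k , k∈∁J)) (inj₂ (l , l∈∁J)) = mk⇔
        (λ { refl → pendant-edge k∈∁J })
        (λ { (σ , ∣σ∣≡d , _ , edge) → El-≡ (Edge-pointed ∣σ∣≡d edge) })

    Stack⇔Field : IsLinkageTree (Stack I J) ⇔ IsLinkageTree (Field I J)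
    Stack⇔Field = IsLinkageTree-⇔ {G = attachPaths (Stack I J) p} {Field I J} El-++ El-∁ Field-shape
      ⇔-∘ IsLinkageTree-attachPaths

  -- Closure comes first, since the comparison of trees presupposes it. Every `τ` of size `suc d` is
  -- some `I ++ ∁ J` with `∣ I ∣ ≡ suc ∣ J ∣`, so the two families of trees have the same index
  -- pairs.
  linkage⇔leftSemiEnsemble : IsLinkage M ⇔ IsLeftSemiEnsemble (reduction M)
  linkage⇔leftSemiEnsemble = mk⇔
    (λ linkage → linkage⇒closure linkage , λ I J e →
      Equivalence.from (Stack⇔Field (linkage⇒closure linkage) I J e) (linkage (I ++ ∁ J) (∣++∁∣⁺ I J 1 e)))
    from
    where
    from : IsLeftSemiEnsemble (reduction M) → IsLinkage M
    from (closure , leftLinkage) τ = let I , J , eq = decompose n d τ in at I J eq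
      where
      at : ∀ (I : Subset n) (J : Subset d) {τ} → I ++ ∁ J ≡ τ → ∣ τ ∣ ≡ suc d →
           IsLinkageTree (UnionGraph (matching M) τ)
      at I J refl ∣τ∣ = Equivalence.to (Stack⇔Field closure I J e) (leftLinkage I J e)
        where
        e : ∣ I ∣ ≡ suc ∣ J ∣
        e = ∣++∁∣⁻ I J 1 ∣τ∣

-- Reduction is a bijection

module _ (N : MatchingStack n d) where

  -- The inverse of restriction: the stack on `I`, and on `∁ J` the identity that pointedness
  -- dictates.
  extend : (I : Subset n) (J : Subset d) → .(∣ I ∣ ≡ ∣ J ∣) → Matching (I ++ ∁ J) (⊤ {d})
  extend I J e = ↔⇒⤖ El-∁ ⤖-∘ ((N I J e ⊎-⤖ ⤖-id _) ⤖-∘ ↔⇒⤖ (↔-sym El-++))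

  extend-↑ˡ : ∀ I J .(e : ∣ I ∣ ≡ ∣ J ∣) i i∈σ i∈I →
              proj₁ (⟦ extend I J e ⟧ (i ↑ˡ d , i∈σ)) ≡ proj₁ (⟦ N I J e ⟧ (i , i∈I))
  extend-↑ˡ I J e i i∈σ i∈I
    rewrite ∈-irrelevant i∈σ (∈-++ˡ⁺ i∈I)
          | Inverse.strictlyInverseʳ (El-++ {I = I} {∁ J}) (inj₁ (i , i∈I)) = refl

  extend-↑ʳ : ∀ I J .(e : ∣ I ∣ ≡ ∣ J ∣) k k∈σ → proj₁ (⟦ extend I J e ⟧ (n ↑ʳ k , k∈σ)) ≡ k
  extend-↑ʳ I J e k k∈σ
    rewrite ∈-irrelevant k∈σ (∈-++ʳ⁺ {I = I} {∁ J} (∈-++ʳ⁻ {I = I} k∈σ))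
          | Inverse.strictlyInverseʳ (El-++ {I = I} {∁ J}) (inj₂ (k , ∈-++ʳ⁻ {I = I} k∈σ)) = refl

  private
    extendTo : (I : Subset n) (J : Subset d) {σ : Subset (n + d)} →
               I ++ ∁ J ≡ σ → .(∣ σ ∣ ≡ d) → Matching σ (⊤ {d})
    extendTo I J refl ∣σ∣≡d = extend I J (∣++∁∣⁻ I J 0 ∣σ∣≡d)

    -- Decomposing `I ++ ∁ J` returns `I` and `J` only up to propositional equality; with `I′` and
    -- `J′` general, these equations can be matched with `refl`.
    extendTo-↑ˡ : {I I′ : Subset n} {J J′ : Subset d} → I′ ≡ I → J′ ≡ J →
                  (eq : I′ ++ ∁ J′ ≡ I ++ ∁ J)
                  .(∣σ∣≡d : ∣ I ++ ∁ J ∣ ≡ d) .(e : ∣ I ∣ ≡ ∣ J ∣) → ∀ i i∈σ i∈I →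
                  proj₁ (⟦ extendTo I′ J′ eq ∣σ∣≡d ⟧ (i ↑ˡ d , i∈σ)) ≡ proj₁ (⟦ N I J e ⟧ (i , i∈I))
    extendTo-↑ˡ {I} {J = J} refl refl refl _ e = extend-↑ˡ I J e

    extendTo-↑ʳ : (I : Subset n) (J : Subset d) {σ : Subset (n + d)}
                  (eq : I ++ ∁ J ≡ σ) .(∣σ∣≡d : ∣ σ ∣ ≡ d) → ∀ k k∈σ →
                  proj₁ (⟦ extendTo I J eq ∣σ∣≡d ⟧ (n ↑ʳ k , k∈σ)) ≡ k
    extendTo-↑ʳ I J refl ∣σ∣≡d = extend-↑ʳ I J (∣++∁∣⁻ I J 0 ∣σ∣≡d)

  extension : PointedMatchingField n d
  extension = record
    { matching = λ σ → let I , J , eq = decompose n d σ in extendTo I J eq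
    ; pointed  = λ σ → let I , J , eq = decompose n d σ in extendTo-↑ʳ I J eq
    }

  reduction-extension : reduction extension ≈ˢ N
  reduction-extension I J e (i , i∈I) =
    let I′ , J′ , eq = decompose n d (I ++ ∁ J) in
    El-≡ (extendTo-↑ˡ (++-injectiveˡ I′ I eq) (∁-injective (++-injectiveʳ I′ I eq))
      eq (∣++∁∣ I J e) e i (∈-++ˡ⁺ i∈I) i∈I)

reduction-cong : {M M′ : PointedMatchingField n d} → M ≈ᶠ M′ → reduction M ≈ˢ reduction M′
reduction-cong M≈M′ I J e x = El-≡ (cong proj₁ (M≈M′ (I ++ ∁ J) (∣++∁∣ I J e) _))

-- The reduction records the values on `[n]`; on the remaining elements pointedness fixes both
-- fields.
reduction-injective : {M M′ : PointedMatchingField n d} → reduction M ≈ˢ reduction M′ → M ≈ᶠ M′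
reduction-injective {n} {d} {M} {M′} M≈M′ σ ∣σ∣≡d (x , x∈σ) with decompose n d σ
... | I , J , refl with splitAt n x in split
...   | inj₁ i with refl ← splitAt⁻¹-↑ˡ {i = x} split =
  subst (λ p → ⟦ matching M σ ∣σ∣≡d ⟧ (x , p) ≡ ⟦ matching M′ σ ∣σ∣≡d ⟧ (x , p))
    (∈-irrelevant _ x∈σ)
    (El-≡ (cong proj₁ (M≈M′ I J (∣++∁∣⁻ I J 0 ∣σ∣≡d) (i , ∈-++ˡ⁻ {K = ∁ J} x∈σ))))
...   | inj₂ k with refl ← splitAt⁻¹-↑ʳ {i = x} split =
  El-≡ (trans (pointed M σ ∣σ∣≡d k x∈σ) (sym (pointed M′ σ ∣σ∣≡d k x∈σ)))

mainTheorem4 : (n d : ℕ) .{{_ : NonZero n}} .{{_ : NonZero d}} →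
    Σ[ iff ∈ ((M : PointedMatchingField n d) → IsLinkage M ⇔ IsLeftSemiEnsemble (reduction M)) ]
    IsBijection
    {A = LinkageField n d} (_≈ᶠ_ on proj₁)
    {B = LeftSemiEnsemble n d} (_≈ˢ_ on proj₁)
    (map reduction (λ {M} → Equivalence.to (iff M)))
mainTheorem4 n d = linkage⇔leftSemiEnsemble , record
  { isInjection = record
    { isCongruent = record
      { cong           = λ {M} {M′} → reduction-cong {M = proj₁ M} {proj₁ M′}
      ; isEquivalence₁ = record
        { refl  = λ _ _ _ → refl
        ; sym   = λ M≈M′ σ ∣σ∣≡d x → sym (M≈M′ σ ∣σ∣≡d x)
        ; trans = λ M≈M′ M′≈M″ σ ∣σ∣≡d x → trans (M≈M′ σ ∣σ∣≡d x) (M′≈M″ σ ∣σ∣≡d x)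
        }
      ; isEquivalence₂ = record
        { refl  = λ _ _ _ _ → refl
        ; sym   = λ N≈N′ I J e x → sym (N≈N′ I J e x)
        ; trans = λ N≈N′ N′≈N″ I J e x → trans (N≈N′ I J e x) (N′≈N″ I J e x)
        }
      }
    ; injective = λ {M} {M′} → reduction-injective {M = proj₁ M} {proj₁ M′}
    }
  -- The reduction of `extension N` agrees with `N` up to `≈ˢ`, so it inherits the semi-ensemble
  -- property, and the equivalence turns this into linkage of the extension. The last component
  -- treats every field `≈ᶠ`-equal to it.
  ; surjective = λ { (N , isLeftSemiEnsemble) →
      ( extension N
      , Equivalence.from (linkage⇔leftSemiEnsemble (extension N))
          (IsLeftSemiEnsemble-resp-≈ˢ {N = N} {reduction (extension N)}
            (λ I J e x → sym (reduction-extension N I J e x)) isLeftSemiEnsemble) ) ,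
      λ {M} M≈extension I J e x → trans
        (reduction-cong {M = proj₁ M} {extension N} M≈extension I J e x)
        (reduction-extension N I J e x) }
  }
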